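{- Let $F_{\mathsf p}=\mathcal D(-)\times\{0,1\}$ on $\mathbf{Sets}$, let $\sigma_{\mathsf p}:F_{\mathsf p}[0,1]\to[0,1]$ be the modality $\sigma_{\mathsf p}(\delta,1)=1$, $\sigma_{\mathsf p}(\delta,0)=\sum_{a\in\mathrm{supp}(\delta)}a\cdot\delta(a)$ over $([0,1],\le)$, and let $\mathbb N_\infty=\mathbb N\cup\{\infty\}$. Define: 1) $r_{\mathsf p}:F_{\mathsf p}(\mathcal D\mathbb N_\infty)\to\mathcal D\mathbb N_\infty$ by, for $(\Gamma,t)\in\mathcal D^2\mathbb N_\infty\times\{0,1\}$ and $a\in\mathbb N_\infty$: $r_{\mathsf p}(\Gamma,t)(a)=1$ if $t=1,a=0$; $r_{\mathsf p}(\Gamma,t)(a)=0$ if ($t=1$ and $a>0$) or ($t=0$ and $a=0$); and $r_{\mathsf p}(\Gamma,t)(a)=\sum_{\gamma\in\mathrm{supp}(\Gamma)}\Gamma(\gamma)\cdot\gamma(a-1)$ if $t=0$ and $a>0$ (where $\infty-1=\infty$); 2) $q_{\mathsf p}:\mathcal D\mathbb N_\infty\to[0,1]$ by $q_{\mathsf p}(\varphi)=\varphi([0,\infty))=\sum_{i\in\mathbb N}\varphi(i)$; 3) $\varphi\sqsubseteq_{\mathcal D\mathbb N_\infty}\varphi'$ iff for all $a\in\mathbb N$, $\varphi([0,a])\le\varphi'([0,a])$, where $\varphi([0,a])=\sum_{i=0}^a\varphi(i)$. Then the triple $(r_{\mathsf p},q_{\mathsf p},\sqsubseteq_{\mathcal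 D\mathbb N_\infty})$ is a ranking domain for $F_{\mathsf p}$ and $\sigma_{\mathsf p}$. Moreover $q_{\mathsf p}\circ r_{\mathsf p}=\sigma_{\mathsf p}\circ F_{\mathsf p}q_{\mathsf p}$.
   Context: $\mathcal D:\mathbf{Sets}\to\mathbf{Sets}$ is the discrete distribution functor: $\mathcal DX=\{d:X\to[0,1]\mid\sum_{x\in X}d(x)=1\}$ and $(\mathcal Df)(d)(y)=\sum_{x\in f^{ -1}(y)}d(x)$; $\mathrm{supp}(d)=\{x\mid d(x)>0\}$. $F_{\mathsf p}f=\mathcal Df\times\mathrm{id}$. For a functor $F:\mathbf{Sets}\to\mathbf{Sets}$, a coalgebra $c:X\to FX$ and an algebra $a:FA\to A$, put $\Phi_{c,a}(f)=a\circ Ff\circ c$ for $f\in A^X$. Functions into a poset are ordered pointwise. An algebra $r:FR\to R$ is corecursive if for every coalgebra $c:X\to FX$ there is exactly one $f:X\to R$ with $f=r\circ Ff\circ c$. Given a complete lattice $(\Omega,\sqsubseteq_\Omega)$ and an algebra (modality) $\sigma:F\Omega\to\Omega$ such that each $\Phi_{c,\sigma}$ is monotone, a ranking domain for $F$ and $\sigma$ is a triple $(r:FR\to R,\,q:R\to\Omega,\,\sqsubseteq_R)$, with $\sqsubseteq_R$ a partial order on $R$, such that: (1) $q\circ r\sqsubseteq_\Omega\sigma\circ Fq$ pointwise; (2) $(R,\sqsubseteq_R)$ is a complete lattice and $\Phi_{c,r}:R^X\to R^X$ is monotone for each coalgebra $c:X\to FX$; (3) $q$ is monotone, strict ($q(\bot_R)=\bot_\Omega$)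 and continuous ($q(\bigsqcup_{a\in K}a)=\bigsqcup_{a\in K}q(a)$ for each $K\subseteq R$); (4) $r$ is corecursive. -}

module Defs where

open import Algebra.Bundles using (CommutativeRing)
open import Algebra.Structures using (IsCommutativeRing)
import Algebra.Properties.AbelianGroup as AbelianGroupProperties
import Algebra.Properties.Ring as RingProperties
import Algebra.Properties.CommutativeSemigroup as CommutativeSemigroupProperties
open import Axiom.ExcludedMiddle using (ExcludedMiddle)
open import Axiom.Extensionality.Propositional using (Extensionality)
open import Data.Bool.Base using (if_then_else_)
open import Data.Empty using (⊥-elim)
open import Data.Fin.Base using (Fin)
open import Data.Fin.Patterns using (0F; 1F)
open import Data.List.Base as List using (List; []; _∷_; _++_; foldr; deduplicate; upTo)
open import Data.List.Membership.Propositional using (_∈_)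
open import Data.List.Membership.Propositional.Properties using (∈-∃++; ∈-++⁺ˡ; ∈-++⁺ʳ; ∈-++⁻; ∈-deduplicate⁺)
open import Data.List.Relation.Unary.All as All using (All; []; _∷_)
open import Data.List.Relation.Unary.AllPairs using ([]; _∷_)
open import Data.List.Relation.Unary.Any using (here; there)
open import Data.List.Relation.Unary.Unique.Propositional using (Unique)
import Data.List.Relation.Unary.Unique.Propositional.Properties as Uniqueₚ
import Data.List.Relation.Unary.Unique.DecPropositional.Properties as DecUniqueₚ
open import Data.Nat.Base using (ℕ; zero; suc)
open import Data.Product using (∃; ∃!; _×_; _,_; proj₁; proj₂; map₁)
open import Data.Sum.Base using (inj₁; inj₂)
open import Function.Base using (_∘_; id)
open import Level using (0ℓ)
open import Relation.Binary.Core using (Rel)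
open import Relation.Binary.Definitions using (DecidableEquality)
open import Relation.Binary.Structures using (IsTotalOrder; IsPartialOrder)
open import Relation.Binary.PropositionalEquality
  using (_≡_; _≢_; _≗_; refl; sym; trans; cong; cong₂; subst; subst₂)
open import Relation.Nullary using (¬_; Dec; yes; no; does)
open import Relation.Nullary.Decidable using (recompute)
open import Relation.Nullary.Construct.Add.Supremum using (_⁺; [_]; ⊤⁺; []-injective)
open import Relation.Unary using (Pred; ∅)

module _ {A : Set} (_⊑_ : Rel A 0ℓ) where

  IsUpperBound IsLowerBound IsLub IsGlb : Pred A 0ℓ → Pred A 0ℓ
  IsUpperBound K b = ∀ {x} → K x → x ⊑ b
  IsLowerBound K b = ∀ {x} → K x → b ⊑ x
  IsLub K s = IsUpperBound K s × (∀ {b} → IsUpperBound K b → s ⊑ b)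
  IsGlb K s = IsLowerBound K s × (∀ {b} → IsLowerBound K b → b ⊑ s)

  record IsCompleteLattice : Set₁ where
    field
      isPartialOrder : IsPartialOrder _≡_ _⊑_
      ⨆              : Pred A 0ℓ → A
      ⨅              : Pred A 0ℓ → A
      ⨆-isLub        : ∀ K → IsLub K (⨆ K)
      ⨅-isGlb        : ∀ K → IsGlb K (⨅ K)

    ⊥ : A
    ⊥ = ⨆ ∅

Image : {A B : Set} → (A → B) → Pred A 0ℓ → Pred B 0ℓ
Image f K b = ∃ λ a → K a × f a ≡ b

Pointwise : {X A : Set} → Rel A 0ℓ → Rel (X → A) 0ℓ
Pointwise _⊑_ f g = ∀ x → f x ⊑ g x

Monotone : {A B : Set} → Rel A 0ℓ → Rel B 0ℓ → (A → B) → Set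
Monotone _⊑₁_ _⊑₂_ f = ∀ {x y} → x ⊑₁ y → f x ⊑₂ f y

record Functor : Set₁ where
  field
    F₀           : Set → Set
    F₁           : {X Y : Set} → (X → Y) → F₀ X → F₀ Y
    identity     : {X : Set} (u : F₀ X) → F₁ id u ≡ u
    homomorphism : {X Y Z : Set} (f : X → Y) (g : Y → Z) (u : F₀ X) →
                   F₁ (g ∘ f) u ≡ F₁ g (F₁ f u)

module _ (F : Functor) where
  open Functor F

  Φ : {X A : Set} → (X → F₀ X) → (F₀ A → A) → (X → A) → (X → A)
  Φ c a f = a ∘ F₁ f ∘ c

  Φ-Monotone : {A : Set} → Rel A 0ℓ → (F₀ A → A) → Set₁
  Φ-Monotone _⊑_ a = {X : Set} (c : X → F₀ X) →
                     Monotone (Pointwise _⊑_) (Pointwise _⊑_) (Φ c a)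

  Corecursive : {R : Set} → (F₀ R → R) → Set₁
  Corecursive {R} r = {X : Set} (c : X → F₀ X) →
                      ∃! _≡_ λ (f : X → R) → f ≡ Φ c r f

  record IsRankingDomain
    {Ω : Set} (_⊑Ω_ : Rel Ω 0ℓ) (Ω-complete : IsCompleteLattice _⊑Ω_)
    (σ : F₀ Ω → Ω) (Φσ-monotone : Φ-Monotone _⊑Ω_ σ)
    {R : Set} (r : F₀ R → R) (q : R → Ω) (_⊑R_ : Rel R 0ℓ) : Set₁ where
    field
      q∘r⊑σ∘Fq    : ∀ u → q (r u) ⊑Ω σ (F₁ q u)
      R-complete  : IsCompleteLattice _⊑R_
      Φr-monotone : Φ-Monotone _⊑R_ r

    module Ω = IsCompleteLattice Ω-complete
    module R = IsCompleteLattice R-complete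

    field
      q-monotone   : Monotone _⊑R_ _⊑Ω_ q
      q-strict     : q R.⊥ ≡ Ω.⊥
      q-continuous : ∀ K → q (R.⨆ K) ≡ Ω.⨆ (Image q K)
      corecursive  : Corecursive r

-- The real numbers: a Dedekind-complete ordered field, which classically
-- is unique up to isomorphism.

record CompleteOrderedField : Set₁ where
  infixl 6 _+_
  infixl 7 _*_
  infix  8 -_
  infix  4 _≤_
  field
    ℝ                 : Set
    _≤_               : Rel ℝ 0ℓ
    _+_ _*_           : ℝ → ℝ → ℝ
    -_                : ℝ → ℝ
    0# 1#             : ℝ
    isCommutativeRing : IsCommutativeRing _≡_ _+_ _*_ -_ 0# 1#
    0≢1               : 0# ≢ 1#
    *-invertible      : ∀ x → x ≢ 0# → ∃ λ y → x * y ≡ 1#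
    isTotalOrder      : IsTotalOrder _≡_ _≤_
    +-monoˡ-≤         : ∀ z {x y} → x ≤ y → x + z ≤ y + z
    *-nonneg          : ∀ {x y} → 0# ≤ x → 0# ≤ y → 0# ≤ x * y
    supremum          : (S : Pred ℝ 0ℓ) → ∃ S → ∃ (IsUpperBound _≤_ S) → ∃ (IsLub _≤_ S)

-- The metatheory of Sets is classical and extensional, whence em and fe.

module Probabilistic
  (em : ExcludedMiddle 0ℓ)
  (fe : Extensionality 0ℓ 0ℓ)
  (𝐑 : CompleteOrderedField)
  where

  open CompleteOrderedField 𝐑

  infix 4 _<_
  _<_ : Rel ℝ 0ℓ
  x < y = x ≤ y × x ≢ y

  sumList : {X : Set} → (X → ℝ) → List X → ℝ
  sumList f = foldr (λ x s → f x + s) 0#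

  PartialSum : {X : Set} → (X → ℝ) → Pred ℝ 0ℓ
  PartialSum f s = ∃ λ xs → Unique xs × sumList f xs ≡ s

  partialSum₀ : {X : Set} (f : X → ℝ) → ∃ (PartialSum f)
  partialSum₀ f = 0# , [] , [] , refl

  ∑-aux : {X : Set} (f : X → ℝ) → Dec (∃ (IsUpperBound _≤_ (PartialSum f))) → ℝ
  ∑-aux f (yes bounded) = proj₁ (supremum (PartialSum f) (partialSum₀ f) bounded)
  ∑-aux f (no _)        = 0#

  -- Meant for f ≥ 0 only: the supremum of the sums over finite subsets,
  -- with the junk value 0 if these are unbounded.
  ∑ : {X : Set} → (X → ℝ) → ℝ
  ∑ f = ∑-aux f em

  -- A sum over a subset P is the sum of f·1_P.
  restrict : {X : Set} → Pred X 0ℓ → (X → ℝ) → X → ℝ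
  restrict P f x = if does (em {P x}) then f x else 0#

  ∑[_] : {X : Set} → Pred X 0ℓ → (X → ℝ) → ℝ
  ∑[ P ] f = ∑ (restrict P f)

  record 𝕀 : Set where
    constructor mk𝕀
    field
      val  : ℝ
      .0≤v : 0# ≤ val
      .v≤1 : val ≤ 1#
  open 𝕀 public using (val)

  infix 4 _≤𝕀_
  _≤𝕀_ : Rel 𝕀 0ℓ
  u ≤𝕀 v = val u ≤ val v

  -- Nonsummable d are excluded: then ∑ is 0, not 1.
  record 𝒟 (X : Set) : Set where
    constructor mk𝒟
    field
      mass   : X → 𝕀
      .sum≡1 : ∑ (val ∘ mass) ≡ 1#

    prob : X → ℝ
    prob x = val (mass x)

  open 𝒟 public using (mass; prob)

  supp : {X : Set} → 𝒟 X → Pred X 0ℓ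
  supp d x = 0# < prob d x

  module Sums where

    ring : CommutativeRing 0ℓ 0ℓ
    ring = record { isCommutativeRing = isCommutativeRing }

    open CommutativeRing ring public
      using ( +-identityˡ; +-identityʳ; +-comm; +-assoc; -‿inverseˡ; -‿inverseʳ
            ; *-comm; *-assoc; *-identityˡ; *-identityʳ; distribˡ; zeroˡ; zeroʳ)
    open RingProperties (CommutativeRing.ring ring) public
      using (-‿distribʳ-*; -‿distribˡ-*)
    open CommutativeSemigroupProperties
      (CommutativeRing.+-commutativeSemigroup ring) public
      using (interchange; x∙yz≈y∙xz)
    open IsTotalOrder isTotalOrder public
      using () renaming (refl to ≤-refl; reflexive to ≤-reflexive; trans to ≤-trans;
                         antisym to ≤-antisym; total to ≤-total)

    +-monoʳ-≤ : ∀ z {x y} → x ≤ y → z + x ≤ z + y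
    +-monoʳ-≤ z {x} {y} p = subst₂ _≤_ (+-comm x z) (+-comm y z) (+-monoˡ-≤ z p)

    +-mono-≤ : ∀ {a b c d} → a ≤ b → c ≤ d → a + c ≤ b + d
    +-mono-≤ {b = b} {c} p q = ≤-trans (+-monoˡ-≤ c p) (+-monoʳ-≤ b q)

    +-nonneg : ∀ {a b} → 0# ≤ a → 0# ≤ b → 0# ≤ a + b
    +-nonneg p q = subst (_≤ _) (+-identityˡ 0#) (+-mono-≤ p q)

    +-cancel-neg : ∀ x y → x + y + - y ≡ x
    +-cancel-neg x y = trans (+-assoc x y (- y))
      (trans (cong (x +_) (-‿inverseʳ y)) (+-identityʳ x))

    neg-cancel : ∀ x y → x + - y + y ≡ x
    neg-cancel x y = trans (+-assoc x (- y) y)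
      (trans (cong (x +_) (-‿inverseˡ y)) (+-identityʳ x))

    ≤-minus : ∀ {x y b} → x + y ≤ b → x ≤ b + - y
    ≤-minus {x} {y} p = subst (_≤ _) (+-cancel-neg x y) (+-monoˡ-≤ (- y) p)

    minus-≤ : ∀ {x y b} → x ≤ b + - y → x + y ≤ b
    minus-≤ {y = y} {b} p = subst (_ ≤_) (neg-cancel b y) (+-monoˡ-≤ y p)

    *-monoˡ-≤ : ∀ {k x y} → 0# ≤ k → x ≤ y → k * x ≤ k * y
    *-monoˡ-≤ {k} {x} {y} 0≤k x≤y =
      subst (_≤ k * y) (+-identityˡ (k * x)) (minus-≤ 0≤k[y-x])
      where
      0≤y-x : 0# ≤ y + - x
      0≤y-x = ≤-minus (subst (_≤ y) (sym (+-identityˡ x)) x≤y)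
      0≤k[y-x] : 0# ≤ k * y + - (k * x)
      0≤k[y-x] = subst (0# ≤_)
        (trans (distribˡ k y (- x)) (cong (k * y +_) (sym (-‿distribʳ-* k x))))
        (*-nonneg 0≤k 0≤y-x)

    0≤1 : 0# ≤ 1#
    0≤1 with ≤-total 0# 1#
    ... | inj₁ p = p
    ... | inj₂ 1≤0 = subst (0# ≤_) eq (*-nonneg 0≤-1 0≤-1)
      where
      0≤-1 : 0# ≤ - 1#
      0≤-1 = subst (0# ≤_) (+-identityˡ (- 1#))
               (≤-minus (subst (_≤ 0#) (sym (+-identityˡ 1#)) 1≤0))
      eq : - 1# * - 1# ≡ 1#
      eq = trans (sym (-‿distribˡ-* 1# (- 1#)))
        (trans (cong -_ (*-identityˡ (- 1#)))
          (AbelianGroupProperties.⁻¹-involutive (CommutativeRing.+-abelianGroup ring) 1#))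

    0≤inverse : ∀ {k l} → 0# ≤ k → k * l ≡ 1# → 0# ≤ l
    0≤inverse {k} {l} 0≤k kl≡1 with ≤-total 0# l
    ... | inj₁ p = p
    ... | inj₂ l≤0 = ⊥-elim (0≢1 (≤-antisym 0≤1
            (subst₂ _≤_ kl≡1 (zeroʳ k) (*-monoˡ-≤ 0≤k l≤0))))

    𝕀-≡ : {u v : 𝕀} → val u ≡ val v → u ≡ v
    𝕀-≡ {mk𝕀 _ _ _} {mk𝕀 _ _ _} refl = refl

    0≤val : ∀ u → 0# ≤ val u
    0≤val (mk𝕀 _ p _) = recompute em p

    val≤1 : ∀ u → val u ≤ 1#
    val≤1 (mk𝕀 _ _ p) = recompute em p

    module _ {X : Set} where

      infix 4 _≟_
      _≟_ : DecidableEquality X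
      x ≟ y = em

      Nonneg : (X → ℝ) → Set
      Nonneg f = ∀ x → 0# ≤ f x

      HasSum : (X → ℝ) → Pred ℝ 0ℓ
      HasSum f = IsLub _≤_ (PartialSum f)

      sumList-cong : {f g : X → ℝ} → f ≗ g → ∀ xs → sumList f xs ≡ sumList g xs
      sumList-cong e []       = refl
      sumList-cong e (x ∷ xs) = cong₂ _+_ (e x) (sumList-cong e xs)

      sumList-mono : {f g : X → ℝ} → (∀ x → f x ≤ g x) → ∀ xs → sumList f xs ≤ sumList g xs
      sumList-mono p []       = ≤-refl
      sumList-mono p (x ∷ xs) = +-mono-≤ (p x) (sumList-mono p xs)

      sumList-nonneg : {f : X → ℝ} → Nonneg f → ∀ xs → 0# ≤ sumList f xs
      sumList-nonneg p []       = ≤-refl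
      sumList-nonneg p (x ∷ xs) = +-nonneg (p x) (sumList-nonneg p xs)

      sumList-0 : ∀ (xs : List X) → sumList (λ _ → 0#) xs ≡ 0#
      sumList-0 []       = refl
      sumList-0 (x ∷ xs) = trans (+-identityˡ _) (sumList-0 xs)

      sumList-+ : (f g : X → ℝ) → ∀ xs →
                  sumList (λ x → f x + g x) xs ≡ sumList f xs + sumList g xs
      sumList-+ f g []       = sym (+-identityˡ 0#)
      sumList-+ f g (x ∷ xs) =
        trans (cong (f x + g x +_) (sumList-+ f g xs)) (interchange _ _ _ _)

      sumList-* : ∀ k (f : X → ℝ) xs → sumList (λ x → k * f x) xs ≡ k * sumList f xs
      sumList-* k f []       = sym (zeroʳ k)
      sumList-* k f (x ∷ xs) =
        trans (cong (k * f x +_) (sumList-* k f xs)) (sym (distribˡ k _ _))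

      sumList-insert : (f : X → ℝ) → ∀ as {x bs} →
                       sumList f (as ++ x ∷ bs) ≡ f x + sumList f (as ++ bs)
      sumList-insert f []       = refl
      sumList-insert f (a ∷ as) =
        trans (cong (f a +_) (sumList-insert f as)) (x∙yz≈y∙xz _ _ _)

      sumList-⊆ : {f : X → ℝ} → Nonneg f → ∀ {xs zs} → Unique xs →
                  (∀ {x} → x ∈ xs → x ∈ zs) → sumList f xs ≤ sumList f zs
      sumList-⊆ nn {[]}     {zs} []       sub = sumList-nonneg nn zs
      sumList-⊆ {f} nn {x ∷ xs} (x∉ ∷ u) sub with ∈-∃++ (sub (here refl))
      ... | as , bs , refl = subst (_ ≤_) (sym (sumList-insert f as))
                               (+-monoʳ-≤ (f x) (sumList-⊆ nn u sub′))
        where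
        sub′ : ∀ {y} → y ∈ xs → y ∈ as ++ bs
        sub′ y∈xs with ∈-++⁻ as (sub (there y∈xs))
        ... | inj₁ y∈as         = ∈-++⁺ˡ y∈as
        ... | inj₂ (there y∈bs) = ∈-++⁺ʳ as y∈bs
        ... | inj₂ (here refl)  = ⊥-elim (All.lookup x∉ y∈xs refl)

      HasSum-unique : {f : X → ℝ} {s t : ℝ} → HasSum f s → HasSum f t → s ≡ t
      HasSum-unique (u , l) (u′ , l′) = ≤-antisym (l u′) (l′ u)

      HasSum-cong : {f g : X → ℝ} {s : ℝ} → f ≗ g → HasSum f s → HasSum g s
      HasSum-cong e h = subst (λ f → HasSum f _) (fe e) h

      sumList≤ : {f : X → ℝ} {s : ℝ} → HasSum f s → ∀ {xs} → Unique xs → sumList f xs ≤ s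
      sumList≤ (u , _) uxs = u (_ , uxs , refl)

      term≤ : {f : X → ℝ} {s : ℝ} → HasSum f s → ∀ x → f x ≤ s
      term≤ {f} h x = subst (_≤ _) (+-identityʳ (f x)) (sumList≤ h ([] ∷ []))

      HasSum⇒0≤ : {f : X → ℝ} {s : ℝ} → HasSum f s → 0# ≤ s
      HasSum⇒0≤ h = sumList≤ h []

      bounded⇒HasSum : (f : X → ℝ) → ∀ b → (∀ {xs} → Unique xs → sumList f xs ≤ b) → HasSum f (∑ f)
      bounded⇒HasSum f b p with em {∃ (IsUpperBound _≤_ (PartialSum f))}
      ... | yes bdd = proj₂ (supremum (PartialSum f) (partialSum₀ f) bdd)
      ... | no ¬bdd = ⊥-elim (¬bdd (b , λ { (_ , u , refl) → p u }))

      HasSum⇒∑≡ : {f : X → ℝ} {s : ℝ} → HasSum f s → ∑ f ≡ s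
      HasSum⇒∑≡ {f} {s} h = HasSum-unique (bounded⇒HasSum f s (sumList≤ h)) h

      ∑≡1⇒HasSum : {f : X → ℝ} → ∑ f ≡ 1# → HasSum f 1#
      ∑≡1⇒HasSum {f} e with em {∃ (IsUpperBound _≤_ (PartialSum f))}
      ... | yes bdd = subst (HasSum f) e (proj₂ (supremum (PartialSum f) (partialSum₀ f) bdd))
      ... | no _    = ⊥-elim (0≢1 e)

      comparison : {f g : X → ℝ} {t : ℝ} → (∀ x → f x ≤ g x) → HasSum g t →
                   HasSum f (∑ f) × ∑ f ≤ t
      comparison {f} {g} {t} f≤g h = hf , proj₂ hf λ { (_ , u , refl) → p u }
        where
        p : ∀ {xs} → Unique xs → sumList f xs ≤ t
        p {xs} u = ≤-trans (sumList-mono f≤g xs) (sumList≤ h u)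
        hf = bounded⇒HasSum f t p

      HasSum-0 : HasSum (λ _ → 0#) 0#
      HasSum-0 = (λ { (xs , _ , refl) → ≤-reflexive (sumList-0 xs) })
               , (λ ub → ub ([] , [] , refl))

      HasSum-+ : {f g : X → ℝ} {s t : ℝ} → Nonneg f → Nonneg g →
                 HasSum f s → HasSum g t → HasSum (λ x → f x + g x) (s + t)
      HasSum-+ {f} {g} {s} {t} nf ng hf hg = upper , least
        where
        upper : IsUpperBound _≤_ (PartialSum (λ x → f x + g x)) (s + t)
        upper (xs , u , refl) = subst (_≤ _) (sym (sumList-+ f g xs))
          (+-mono-≤ (sumList≤ hf u) (sumList≤ hg u))
        least : ∀ {b} → IsUpperBound _≤_ (PartialSum (λ x → f x + g x)) b → s + t ≤ b
        least {b} ub = minus-≤ (proj₂ hf λ { (xs , uxs , refl) →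
            ≤-minus (subst (_≤ b) (+-comm t _) (minus-≤ (proj₂ hg λ { (ys , uys , refl) →
              ≤-minus (subst (_≤ b) (+-comm (sumList f xs) (sumList g ys)) (both uxs uys)) })))})
          where
          both : ∀ {xs ys} → Unique xs → Unique ys → sumList f xs + sumList g ys ≤ b
          both {xs} {ys} uxs uys = ≤-trans
              (+-mono-≤
                (sumList-⊆ nf {zs = zs} uxs (λ i → ∈-deduplicate⁺ _≟_ (∈-++⁺ˡ i)))
                (sumList-⊆ ng {zs = zs} uys (λ i → ∈-deduplicate⁺ _≟_ (∈-++⁺ʳ xs i))))
              (subst (_≤ b) (sumList-+ f g zs)
                (ub (zs , DecUniqueₚ.deduplicate-! _≟_ (xs ++ ys) , refl)))
            where
            zs = deduplicate _≟_ (xs ++ ys)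

      HasSum-* : {f : X → ℝ} {s : ℝ} → ∀ {k} → 0# ≤ k → HasSum f s →
                 HasSum (λ x → k * f x) (k * s)
      HasSum-* {f} {s} {k} 0≤k h with em {k ≡ 0#}
      ... | yes refl = subst₂ HasSum (fe (λ x → sym (zeroˡ (f x)))) (sym (zeroˡ s)) HasSum-0
      ... | no k≢0 with *-invertible k k≢0
      ...   | l , kl≡1 = upper , least
        where
        cancel : ∀ {u v} → u * v ≡ 1# → ∀ x → u * (v * x) ≡ x
        cancel e x = trans (sym (*-assoc _ _ x)) (trans (cong (_* x) e) (*-identityˡ x))
        lk≡1 = trans (*-comm l k) kl≡1
        0≤l = 0≤inverse 0≤k kl≡1
        upper : IsUpperBound _≤_ (PartialSum (λ x → k * f x)) (k * s)
        upper (xs , u , refl) =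
          subst (_≤ _) (sym (sumList-* k f xs)) (*-monoˡ-≤ 0≤k (sumList≤ h u))
        least : ∀ {b} → IsUpperBound _≤_ (PartialSum (λ x → k * f x)) b → k * s ≤ b
        least {b} ub = subst (k * s ≤_) (cancel kl≡1 b) (*-monoˡ-≤ 0≤k
          (proj₂ h λ { (xs , u , refl) →
            subst (_≤ l * b) (trans (cong (l *_) (sumList-* k f xs)) (cancel lk≡1 _))
              (*-monoˡ-≤ 0≤l (ub (xs , u , refl))) }))

      restrict-yes : ∀ (P : Pred X 0ℓ) f {x} → P x → restrict P f x ≡ f x
      restrict-yes P f {x} p with em {P x}
      ... | yes _ = refl
      ... | no ¬p = ⊥-elim (¬p p)

      restrict-no : ∀ (P : Pred X 0ℓ) f {x} → ¬ P x → restrict P f x ≡ 0#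
      restrict-no P f {x} ¬p with em {P x}
      ... | yes p = ⊥-elim (¬p p)
      ... | no _  = refl

      restrict-nonneg : ∀ (P : Pred X 0ℓ) {f} → Nonneg f → Nonneg (restrict P f)
      restrict-nonneg P nn x with em {P x}
      ... | yes _ = nn x
      ... | no _  = ≤-refl

      restrict-≤ : ∀ (P : Pred X 0ℓ) {f} → Nonneg f → ∀ x → restrict P f x ≤ f x
      restrict-≤ P nn x with em {P x}
      ... | yes _ = ≤-refl
      ... | no _  = nn x

      HasSum-singleton : ∀ (P : Pred X 0ℓ) (f : X → ℝ) x → 0# ≤ f x → P x →
                         (∀ {y} → P y → x ≡ y) → HasSum (restrict P f) (f x)
      HasSum-singleton P f x 0≤fx Px only = upper , least
        where
        zero-off : ∀ {xs} → All (x ≢_) xs → sumList (restrict P f) xs ≡ 0#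
        zero-off []           = refl
        zero-off (x≢y ∷ x∉ys) =
          trans (cong₂ _+_ (restrict-no P f (λ Py → x≢y (only Py))) (zero-off x∉ys)) (+-identityˡ 0#)
        bound : ∀ {xs} → Unique xs → sumList (restrict P f) xs ≤ f x
        bound []                   = 0≤fx
        bound {y ∷ ys} (y∉ys ∷ u) with em {x ≡ y}
        ... | yes refl = ≤-reflexive
              (trans (cong₂ _+_ (restrict-yes P f Px) (zero-off y∉ys)) (+-identityʳ (f x)))
        ... | no x≢y = subst (_≤ f x)
              (sym (trans (cong (_+ sumList (restrict P f) ys) (restrict-no P f (λ Py → x≢y (only Py))))
                (+-identityˡ _))) (bound u)
        upper : IsUpperBound _≤_ (PartialSum (restrict P f)) (f x)
        upper (_ , u , refl) = bound u
        least : ∀ {b} → IsUpperBound _≤_ (PartialSum (restrict P f)) b → f x ≤ b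
        least {b} ub = subst (_≤ b) (trans (+-identityʳ _) (restrict-yes P f Px))
                         (ub (x ∷ [] , [] ∷ [] , refl))

    module Swap {I Y : Set} {f : I → Y → ℝ} {s : I → ℝ} {t : ℝ}
                (nn : ∀ i y → 0# ≤ f i y)
                (rows : ∀ i → HasSum (f i) (s i)) (total : HasSum s t) where

      column : ∀ y → HasSum (λ i → f i y) (∑ (λ i → f i y))
      column y = proj₁ (comparison (λ i → term≤ (rows i) y) total)

      columns : ∀ ys → HasSum (λ i → sumList (f i) ys) (sumList (λ y → ∑ (λ i → f i y)) ys)
      columns []       = HasSum-0
      columns (y ∷ ys) =
        HasSum-+ (λ i → nn i y) (λ i → sumList-nonneg (nn i) ys) (column y) (columns ys)

      finiteRows : ∀ xs → HasSum (λ y → sumList (λ i → f i y) xs) (sumList s xs)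
      finiteRows []       = HasSum-0
      finiteRows (i ∷ xs) =
        HasSum-+ (nn i) (λ y → sumList-nonneg (λ j → nn j y) xs) (rows i) (finiteRows xs)

      exchange : ∀ xs ys → sumList (λ y → sumList (λ i → f i y) xs) ys
                         ≡ sumList (λ i → sumList (f i) ys) xs
      exchange []       ys = sumList-0 ys
      exchange (i ∷ xs) ys = trans (sumList-+ (f i) (λ y → sumList (λ j → f j y) xs) ys)
                               (cong (sumList (f i) ys +_) (exchange xs ys))

      swap : HasSum (λ y → ∑ (λ i → f i y)) t
      swap = upper , least
        where
        upper : IsUpperBound _≤_ (PartialSum (λ y → ∑ (λ i → f i y))) t
        upper (ys , uys , refl) = proj₂ (columns ys) λ { (xs , uxs , refl) →
          ≤-trans (sumList-mono (λ i → sumList≤ (rows i) uys) xs) (sumList≤ total uxs) }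
        least : ∀ {b} → IsUpperBound _≤_ (PartialSum (λ y → ∑ (λ i → f i y))) b → t ≤ b
        least {b} ub = proj₂ total λ { (xs , uxs , refl) →
          proj₂ (finiteRows xs) λ { (ys , uys , refl) →
            ≤-trans (sumList-mono (λ y → sumList≤ (column y) uxs) ys) (ub (ys , uys , refl)) } }

    module _ {X : Set} where

      prob-nonneg : (d : 𝒟 X) → Nonneg (prob d)
      prob-nonneg d x = 0≤val (mass d x)

      prob-sum : (d : 𝒟 X) → HasSum (prob d) 1#
      prob-sum (mk𝒟 m e) = ∑≡1⇒HasSum (recompute em e)

      𝒟-≡ : {d e : 𝒟 X} → prob d ≗ prob e → d ≡ e
      𝒟-≡ {mk𝒟 m _} {mk𝒟 n _} p with refl ← fe {f = m} {g = n} (λ x → 𝕀-≡ (p x)) = refl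

      mkDist : (f : X → ℝ) → Nonneg f → HasSum f 1# → 𝒟 X
      mkDist f nn h = record
        { mass  = λ x → mk𝕀 (f x) (nn x) (term≤ h x)
        ; sum≡1 = HasSum⇒∑≡ h
        }

  open Sums using (mkDist)

  𝒟map-prob : {X Y : Set} → (X → Y) → 𝒟 X → Y → ℝ
  𝒟map-prob f d y = ∑[ (λ x → f x ≡ y) ] (prob d)

  module 𝒟map-wellDefined {X Y : Set} (f : X → Y) (d : 𝒟 X) where
    open Sums

    module M = Swap {f = λ x y → restrict (λ x → f x ≡ y) (prob d) x}
      (λ x y → restrict-nonneg (λ x → f x ≡ y) (prob-nonneg d) x)
      (λ x → HasSum-singleton (f x ≡_) (λ _ → prob d x) (f x) (prob-nonneg d x) refl id)
      (prob-sum d)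

    column : ∀ y → HasSum (restrict (λ x → f x ≡ y) (prob d)) (𝒟map-prob f d y)
    column = M.column

    nonneg : ∀ y → 0# ≤ 𝒟map-prob f d y
    nonneg y = HasSum⇒0≤ (column y)

    sums : HasSum (𝒟map-prob f d) 1#
    sums = M.swap

  𝒟map : {X Y : Set} → (X → Y) → 𝒟 X → 𝒟 Y
  𝒟map f d = mkDist (𝒟map-prob f d) nonneg sums
    where open 𝒟map-wellDefined f d

  module 𝒟-laws where
    open Sums

    𝒟map-id : {X : Set} (d : 𝒟 X) → 𝒟map id d ≡ d
    𝒟map-id d = 𝒟-≡ λ y →
      HasSum⇒∑≡ (HasSum-singleton (λ x → x ≡ y) (prob d) y (prob-nonneg d y) refl sym)

    𝒟map-∘ : {X Y Z : Set} (f : X → Y) (g : Y → Z) (d : 𝒟 X) →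
             𝒟map (g ∘ f) d ≡ 𝒟map g (𝒟map f d)
    𝒟map-∘ {X} {Y} f g d = 𝒟-≡ λ z →
      sym (HasSum⇒∑≡ (HasSum-cong (col z) (Swap.swap (nn z) (row z) (tot z))))
      where
      k : ∀ z → X → Y → ℝ
      k z x y = restrict (λ y → g y ≡ z) (λ y → restrict (λ x → f x ≡ y) (prob d) x) y
      nn : ∀ z x y → 0# ≤ k z x y
      nn z x y = restrict-nonneg (λ y → g y ≡ z)
                   (λ y → restrict-nonneg (λ x → f x ≡ y) (prob-nonneg d) x) y
      row : ∀ z x → HasSum (k z x) (restrict (λ x → g (f x) ≡ z) (prob d) x)
      row z x = HasSum-cong comm
        (HasSum-singleton (f x ≡_) _ (f x)
          (restrict-nonneg (λ x → g (f x) ≡ z) (prob-nonneg d) x) refl id)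
        where
        comm : restrict (f x ≡_) (λ y → restrict (λ _ → g y ≡ z) (prob d) x) ≗ k z x
        comm y with em {f x ≡ y} | em {g y ≡ z}
        ... | yes _ | yes _ = refl
        ... | yes _ | no _  = refl
        ... | no _  | yes _ = refl
        ... | no _  | no _  = refl
      tot : ∀ z → HasSum (restrict (λ x → g (f x) ≡ z) (prob d)) (𝒟map-prob (g ∘ f) d z)
      tot = 𝒟map-wellDefined.column (g ∘ f) d
      col : ∀ z → (λ y → ∑ (λ x → k z x y)) ≗ restrict (λ y → g y ≡ z) (𝒟map-prob f d)
      col z y with em {g y ≡ z}
      ... | yes _ = refl
      ... | no _  = HasSum⇒∑≡ HasSum-0

  𝒟-functor : Functor
  𝒟-functor = record
    { F₀           = 𝒟
    ; F₁           = 𝒟map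
    ; identity     = 𝒟-laws.𝒟map-id
    ; homomorphism = 𝒟-laws.𝒟map-∘
    }

  Fₚ : Functor
  Fₚ = record
    { F₀           = λ X → 𝒟 X × Fin 2
    ; F₁           = λ f → map₁ (𝒟map f)
    ; identity     = λ (d , t) → cong (_, t) (𝒟-laws.𝒟map-id d)
    ; homomorphism = λ f g (d , t) → cong (_, t) (𝒟-laws.𝒟map-∘ f g d)
    }

  σ-value : 𝒟 𝕀 → ℝ
  σ-value δ = ∑[ supp δ ] (λ a → val a * prob δ a)

  module σ-wellDefined (δ : 𝒟 𝕀) where
    open Sums

    term-nonneg : ∀ a → 0# ≤ val a * prob δ a
    term-nonneg a = *-nonneg (0≤val a) (prob-nonneg δ a)

    term-≤ : ∀ a → restrict (supp δ) (λ a → val a * prob δ a) a ≤ prob δ a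
    term-≤ a = ≤-trans (restrict-≤ (supp δ) term-nonneg a)
      (subst₂ _≤_ (*-comm (prob δ a) (val a)) (*-identityʳ (prob δ a))
        (*-monoˡ-≤ (prob-nonneg δ a) (val≤1 a)))

    sums : HasSum (restrict (supp δ) (λ a → val a * prob δ a)) (σ-value δ) × σ-value δ ≤ 1#
    sums = comparison term-≤ (prob-sum δ)

    nonneg : 0# ≤ σ-value δ
    nonneg = HasSum⇒0≤ (proj₁ sums)

  σₚ : 𝒟 𝕀 × Fin 2 → 𝕀
  σₚ (δ , 1F) = mk𝕀 1# Sums.0≤1 Sums.≤-refl
  σₚ (δ , 0F) = mk𝕀 (σ-value δ) nonneg (proj₂ sums)
    where open σ-wellDefined δ

  ℕ∞ : Set
  ℕ∞ = ℕ ⁺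

  average : 𝒟 (𝒟 ℕ∞) → ℕ∞ → ℝ
  average Γ b = ∑[ supp Γ ] (λ γ → prob Γ γ * prob γ b)

  r-prob : 𝒟 (𝒟 ℕ∞) → Fin 2 → ℕ∞ → ℝ
  r-prob Γ 1F [ zero ]  = 1#
  r-prob Γ 1F [ suc n ] = 0#
  r-prob Γ 1F ⊤⁺        = 0#
  r-prob Γ 0F [ zero ]  = 0#
  r-prob Γ 0F [ suc n ] = average Γ [ n ]
  r-prob Γ 0F ⊤⁺        = average Γ ⊤⁺

  module r-wellDefined where
    open Sums

    suc∞ : ℕ∞ → ℕ∞
    suc∞ [ n ] = [ suc n ]
    suc∞ ⊤⁺    = ⊤⁺

    suc∞-injective : ∀ {a b} → suc∞ a ≡ suc∞ b → a ≡ b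
    suc∞-injective {[ _ ]} {[ _ ]} refl = refl
    suc∞-injective {[ _ ]} {⊤⁺} ()
    suc∞-injective {⊤⁺} {[ _ ]} ()
    suc∞-injective {⊤⁺} {⊤⁺} refl = refl

    shift : (ℕ∞ → ℝ) → ℕ∞ → ℝ
    shift f [ zero ]  = 0#
    shift f [ suc n ] = f [ n ]
    shift f ⊤⁺        = f ⊤⁺

    shift-nonneg : ∀ {f} → Nonneg f → Nonneg (shift f)
    shift-nonneg nn [ zero ]  = ≤-refl
    shift-nonneg nn [ suc n ] = nn [ n ]
    shift-nonneg nn ⊤⁺        = nn ⊤⁺

    𝒟map-suc∞ : ∀ γ → 𝒟map-prob suc∞ γ ≗ shift (prob γ)
    𝒟map-suc∞ γ [ zero ] = HasSum⇒∑≡ (HasSum-cong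
      (λ x → sym (restrict-no (λ x → suc∞ x ≡ [ zero ]) (prob γ) (suc∞≢0 x))) HasSum-0)
      where
      suc∞≢0 : ∀ x → suc∞ x ≢ [ zero ]
      suc∞≢0 [ _ ] ()
      suc∞≢0 ⊤⁺ ()
    𝒟map-suc∞ γ [ suc n ] = HasSum⇒∑≡
      (HasSum-singleton _ (prob γ) [ n ] (prob-nonneg γ _) refl (sym ∘ suc∞-injective))
    𝒟map-suc∞ γ ⊤⁺ = HasSum⇒∑≡
      (HasSum-singleton _ (prob γ) ⊤⁺ (prob-nonneg γ _) refl (sym ∘ suc∞-injective))

    shift-sum : ∀ γ → HasSum (shift (prob γ)) 1#
    shift-sum γ = HasSum-cong (𝒟map-suc∞ γ) (𝒟map-wellDefined.sums suc∞ γ)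

    module _ (Γ : 𝒟 (𝒟 ℕ∞)) where

      k : 𝒟 ℕ∞ → ℕ∞ → ℝ
      k γ a = restrict (supp Γ) (λ γ → prob Γ γ * shift (prob γ) a) γ

      k≡ : ∀ γ a → prob Γ γ * shift (prob γ) a ≡ k γ a
      k≡ γ a with em {supp Γ γ}
      ... | yes _ = refl
      ... | no ¬p with em {0# ≡ prob Γ γ}
      ...   | yes 0≡p = trans (cong (_* shift (prob γ) a) (sym 0≡p)) (zeroˡ _)
      ...   | no 0≢p  = ⊥-elim (¬p (prob-nonneg Γ γ , 0≢p))

      k-nonneg : ∀ γ a → 0# ≤ k γ a
      k-nonneg γ a = subst (0# ≤_) (k≡ γ a)
        (*-nonneg (prob-nonneg Γ γ) (shift-nonneg (prob-nonneg γ) a))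

      module M = Swap k-nonneg
        (λ γ → subst (HasSum (k γ)) (*-identityʳ (prob Γ γ))
          (HasSum-cong (k≡ γ) (HasSum-* (prob-nonneg Γ γ) (shift-sum γ))))
        (prob-sum Γ)

      r-prob-0F : ∀ a → ∑ (λ γ → k γ a) ≡ r-prob Γ 0F a
      r-prob-0F [ zero ]  = HasSum⇒∑≡ (HasSum-cong
        (λ γ → trans (sym (zeroʳ (prob Γ γ))) (k≡ γ [ zero ])) HasSum-0)
      r-prob-0F [ suc n ] = refl
      r-prob-0F ⊤⁺        = refl

      nonneg : ∀ t → Nonneg (r-prob Γ t)
      nonneg 1F [ zero ]  = 0≤1
      nonneg 1F [ suc n ] = ≤-refl
      nonneg 1F ⊤⁺        = ≤-refl
      nonneg 0F a = subst (0# ≤_) (r-prob-0F a) (HasSum⇒0≤ (M.column a))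

      dirac : restrict ([ zero ] ≡_) (λ _ → 1#) ≗ r-prob Γ 1F
      dirac [ zero ]  = restrict-yes ([ zero ] ≡_) (λ _ → 1#) refl
      dirac [ suc n ] = restrict-no ([ zero ] ≡_) (λ _ → 1#) λ ()
      dirac ⊤⁺        = restrict-no ([ zero ] ≡_) (λ _ → 1#) λ ()

      sums : ∀ t → HasSum (r-prob Γ t) 1#
      sums 0F = HasSum-cong r-prob-0F M.swap
      sums 1F = HasSum-cong dirac (HasSum-singleton _ _ [ zero ] 0≤1 refl id)

  rₚ : 𝒟 (𝒟 ℕ∞) × Fin 2 → 𝒟 ℕ∞
  rₚ (Γ , t) = mkDist (r-prob Γ t) (nonneg Γ t) (sums Γ t)
    where open r-wellDefined

  q-value : 𝒟 ℕ∞ → ℝ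
  q-value φ = ∑ {ℕ} (λ i → prob φ [ i ])

  module q-wellDefined (φ : 𝒟 ℕ∞) where
    open Sums

    sumList-[] : ∀ is → sumList (λ i → prob φ [ i ]) is ≡ sumList (prob φ) (List.map [_] is)
    sumList-[] []       = refl
    sumList-[] (i ∷ is) = cong (prob φ [ i ] +_) (sumList-[] is)

    bound : ∀ {is} → Unique is → sumList (λ i → prob φ [ i ]) is ≤ 1#
    bound {is} u = subst (_≤ 1#) (sym (sumList-[] is))
                     (sumList≤ (prob-sum φ) (Uniqueₚ.map⁺ []-injective u))

    sums : HasSum (λ i → prob φ [ i ]) (q-value φ)
    sums = bounded⇒HasSum _ 1# bound

    nonneg : 0# ≤ q-value φ
    nonneg = HasSum⇒0≤ sums

    ≤1 : q-value φ ≤ 1#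
    ≤1 = proj₂ sums λ { (_ , u , refl) → bound u }

  qₚ : 𝒟 ℕ∞ → 𝕀
  qₚ φ = mk𝕀 (q-value φ) nonneg ≤1
    where open q-wellDefined φ

  -- φ([0,a])
  cdf : 𝒟 ℕ∞ → ℕ → ℝ
  cdf φ a = sumList (λ i → prob φ [ i ]) (upTo (suc a))

  infix 4 _⊑_
  _⊑_ : Rel (𝒟 ℕ∞) 0ℓ
  φ ⊑ φ′ = ∀ a → cdf φ a ≤ cdf φ′ a

{-# OPTIONS --safe #-}
module Submission where

-- Write below n φ = φ([0,n)). Then φ ↦ (below n φ)ₙ identifies 𝒟 ℕ∞ with the
-- increasing sequences in [0,1] starting at 0, ordered pointwise (the missing
-- mass sits at ∞), so suprema are pointwise, and q is the supremum of the
-- sequence. The algebra r is governed by below (n+1) ∘ r = σ ∘ F (below n):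
-- hence below n ∘ f, for a fixed point f of Φ c r, must be the n-th Kleene
-- iterate of Φ c σ, and conversely these iterates define a fixed point. Letting
-- n → ∞ in the same equation, with σ(F g (d,0)) = ∑ₓ d(x) g(x) and an exchange
-- of sums, gives q ∘ r = σ ∘ F q.

open import Axiom.ExcludedMiddle using (ExcludedMiddle)
open import Axiom.Extensionality.Propositional using (Extensionality)
open import Data.Empty using (⊥-elim)
open import Data.Fin.Patterns using (0F; 1F)
open import Data.List.Base using ([]; _∷_; map; upTo)
open import Data.List.Extrema.Nat using (max; xs≤max)
open import Data.List.Membership.Propositional.Properties using (∈-upTo⁺)
open import Data.List.Properties using (++-identityʳ; map-upTo; upTo-∷ʳ)
import Data.List.Relation.Unary.All as All
open import Data.List.Relation.Unary.Unique.Propositional using (Unique)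
import Data.List.Relation.Unary.Unique.Propositional.Properties as Uniqueₚ
open import Data.Nat.Base using (ℕ; zero; suc; s≤s)
open import Data.Nat.Properties using (suc-injective)
open import Data.Product using (∃; Σ-syntax; _×_; _,_; proj₁; proj₂)
open import Data.Sum.Base using (_⊎_; inj₁; inj₂)
open import Level using (0ℓ)
open import Relation.Binary.Core using (Rel)
open import Relation.Binary.Structures using (IsPartialOrder)
open import Relation.Binary.PropositionalEquality
  using (_≡_; _≗_; refl; sym; trans; cong; cong₂; subst; isEquivalence)
open import Relation.Nullary using (yes; no)
open import Relation.Nullary.Construct.Add.Supremum using ([_]; ⊤⁺; []-injective)
open import Relation.Unary using (Pred; ∅)
open import Function.Base using (_∘_; id)
open import Defs

-- Infima are suprema of sets of lower bounds, so below only suprema are constructed.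
completeLattice : {A : Set} {_⊑_ : Rel A 0ℓ} → IsPartialOrder _≡_ _⊑_ →
                  (⨆ : Pred A 0ℓ → A) → (∀ K → IsLub _⊑_ K (⨆ K)) → IsCompleteLattice _⊑_
completeLattice {_⊑_ = _⊑_} isPartialOrder ⨆ ⨆-isLub = record
  { isPartialOrder = isPartialOrder
  ; ⨆              = ⨆
  ; ⨅              = λ K → ⨆ (IsLowerBound _⊑_ K)
  ; ⨆-isLub        = ⨆-isLub
  ; ⨅-isGlb        = λ K →
      (λ Kx → proj₂ (⨆-isLub (IsLowerBound _⊑_ K)) (λ lower → lower Kx))
    , (λ lower → proj₁ (⨆-isLub (IsLowerBound _⊑_ K)) lower)
  }

module RankingDomain
  (em : ExcludedMiddle 0ℓ)
  (fe : Extensionality 0ℓ 0ℓ)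
  (𝐑 : CompleteOrderedField)
  where

  open CompleteOrderedField 𝐑
  open Probabilistic em fe 𝐑
  open Sums
  open Functor Fₚ using (F₁; homomorphism)

  +-cancelʳ : ∀ {x y} z → x + z ≡ y + z → x ≡ y
  +-cancelʳ {x} {y} z e =
    trans (sym (+-cancel-neg x z)) (trans (cong (_+ - z) e) (+-cancel-neg y z))

  -- The unit interval

  0𝕀 : 𝕀
  0𝕀 = mk𝕀 0# ≤-refl 0≤1

  ≤𝕀-isPartialOrder : IsPartialOrder _≡_ _≤𝕀_
  ≤𝕀-isPartialOrder = record
    { isPreorder = record
      { isEquivalence = isEquivalence
      ; reflexive     = λ { refl → ≤-refl }
      ; trans         = ≤-trans
      }
    ; antisym = λ u≤v v≤u → 𝕀-≡ (≤-antisym u≤v v≤u)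
    }

  -- 0# is adjoined so that the empty set has a supremum.
  ValueOrZero : Pred 𝕀 0ℓ → Pred ℝ 0ℓ
  ValueOrZero K x = x ≡ 0# ⊎ Image val K x

  sup𝕀 : (K : Pred 𝕀 0ℓ) → ∃ (IsLub _≤_ (ValueOrZero K))
  sup𝕀 K = supremum (ValueOrZero K) (0# , inj₁ refl) (1# , bounded)
    where
    bounded : IsUpperBound _≤_ (ValueOrZero K) 1#
    bounded (inj₁ refl)           = 0≤1
    bounded (inj₂ (u , _ , refl)) = val≤1 u

  ⨆𝕀 : Pred 𝕀 0ℓ → 𝕀
  ⨆𝕀 K = mk𝕀 (proj₁ (sup𝕀 K))
    (proj₁ (proj₂ (sup𝕀 K)) (inj₁ refl))
    (proj₂ (proj₂ (sup𝕀 K)) λ { (inj₁ refl) → 0≤1 ; (inj₂ (u , _ , refl)) → val≤1 u })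

  ⨆𝕀-isLub : ∀ K → IsLub _≤𝕀_ K (⨆𝕀 K)
  ⨆𝕀-isLub K =
      (λ {u} Ku → proj₁ (proj₂ (sup𝕀 K)) (inj₂ (u , Ku , refl)))
    , (λ {b} upper → proj₂ (proj₂ (sup𝕀 K))
        λ { (inj₁ refl) → 0≤val b ; (inj₂ (_ , Ku , refl)) → upper Ku })

  𝕀-complete : IsCompleteLattice _≤𝕀_
  𝕀-complete = completeLattice ≤𝕀-isPartialOrder ⨆𝕀 ⨆𝕀-isLub

  𝕀-lub-unique : ∀ {K u v} → IsLub _≤𝕀_ K u → IsLub _≤𝕀_ K v → u ≡ v
  𝕀-lub-unique {u = u} {v} (upper , least) (upper′ , least′) =
    𝕀-≡ (≤-antisym (least {v} upper′) (least′ {u} upper))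

  -- Expectations

  -- Since `g` is at most 1, the terms are dominated by `prob d`, which sums to 1.
  integrable : {X : Set} (d : 𝒟 X) (g : X → 𝕀) →
               HasSum (λ x → prob d x * val (g x)) (∑ (λ x → prob d x * val (g x)))
  integrable d g = proj₁ (comparison
    (λ x → subst (prob d x * val (g x) ≤_) (*-identityʳ (prob d x)) (*-monoˡ-≤ (prob-nonneg d x) (val≤1 (g x))))
    (prob-sum d))

  -- Place the weight of each `x` in column `f x` of an `X` by `Y` matrix. The rows sum to the
  -- weights, the columns to the terms of the pushforward, and `Swap` exchanges the two summations.
  changeOfVariables : {X Y : Set} (f : X → Y) (d : 𝒟 X) (g : Y → 𝕀) {s : ℝ} →
                      HasSum (λ x → prob d x * val (g (f x))) s →
                      HasSum (λ y → prob (𝒟map f d) y * val (g y)) s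
  changeOfVariables {X} {Y} f d g = HasSum-cong column ∘ Swap.swap
    (λ x → restrict-nonneg (f x ≡_) (λ _ → weight-nonneg x))
    (λ x → HasSum-singleton (f x ≡_) (λ _ → weight x) (f x) (weight-nonneg x) refl id)
    where
    weight : X → ℝ
    weight x = prob d x * val (g (f x))
    weight-nonneg : Nonneg weight
    weight-nonneg x = *-nonneg (prob-nonneg d x) (0≤val (g (f x)))
    entry : ∀ y → (λ x → val (g y) * restrict (λ x → f x ≡ y) (prob d) x)
                ≗ λ x → restrict (f x ≡_) (λ _ → weight x) y
    entry y x with em {f x ≡ y}
    ... | yes refl = *-comm _ _
    ... | no _     = zeroʳ _
    column : (λ y → ∑ (λ x → restrict (f x ≡_) (λ _ → weight x) y))
             ≗ λ y → prob (𝒟map f d) y * val (g y)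
    column y = trans
      (HasSum⇒∑≡ (HasSum-cong (entry y)
        (HasSum-* (0≤val (g y)) (𝒟map-wellDefined.column f d y))))
      (*-comm _ _)

  restrict-supp : {X : Set} (d : 𝒟 X) (f : X → ℝ) →
                  (λ x → prob d x * f x) ≗ restrict (supp d) (λ x → prob d x * f x)
  restrict-supp d f x with em {supp d x}
  ... | yes _ = refl
  -- Outside the support the probability is 0, as it is nonnegative and not strictly positive.
  ... | no ¬p with em {0# ≡ prob d x}
  ...   | yes 0≡p = trans (cong (_* f x) (sym 0≡p)) (zeroˡ _)
  ...   | no 0≢p  = ⊥-elim (¬p (prob-nonneg d x , 0≢p))

  -- `σₚ` is the mean of the pushforward of `d` along `g`, so a change of variables turns it into a
  -- sum over `X`.
  σ-expectation : {X : Set} (d : 𝒟 X) (g : X → 𝕀) →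
                  HasSum (λ x → prob d x * val (g x)) (val (σₚ (F₁ g (d , 0F))))
  σ-expectation d g = subst (HasSum _) (sym σ≡) (integrable d g)
    where
    δ = 𝒟map g d
    σ≡ : σ-value δ ≡ ∑ (λ x → prob d x * val (g x))
    σ≡ = trans
      (cong (λ w → ∑[ supp δ ] w) (fe λ a → *-comm (val a) (prob δ a)))
      (HasSum⇒∑≡ (HasSum-cong (restrict-supp δ val)
        (changeOfVariables g d id (integrable d g))))

  -- Stated for a single `u`, as it also serves `q-r`, `Φr-monotone` and the growth of the iterates.
  σF-mono : {X : Set} {f g : X → 𝕀} → Pointwise _≤𝕀_ f g →
            ∀ u → σₚ (F₁ f u) ≤𝕀 σₚ (F₁ g u)
  σF-mono f≤g (d , 1F) = ≤-refl
  σF-mono {f = f} {g} f≤g (d , 0F) = proj₂ (σ-expectation d f) λ { (xs , u , refl) →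
    ≤-trans (sumList-mono (λ x → *-monoˡ-≤ (prob-nonneg d x) (f≤g x)) xs)
            (sumList≤ (σ-expectation d g) u) }

  Φσ-monotone : Φ-Monotone Fₚ _≤𝕀_ σₚ
  Φσ-monotone c f≤g x = σF-mono f≤g (c x)

  -- Sums over ℕ and ℕ∞

  sumList-map : {X Y : Set} (f : Y → ℝ) (g : X → Y) → ∀ xs →
                sumList f (map g xs) ≡ sumList (f ∘ g) xs
  sumList-map f g []       = refl
  sumList-map f g (x ∷ xs) = cong (f (g x) +_) (sumList-map f g xs)

  sumList-upTo-suc : (f : ℕ → ℝ) → ∀ n →
                     sumList f (upTo (suc n)) ≡ f n + sumList f (upTo n)
  sumList-upTo-suc f n = trans (cong (sumList f) (sym (upTo-∷ʳ n)))
    (trans (sumList-insert f (upTo n))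
      (cong (λ is → f n + sumList f is) (++-identityʳ (upTo n))))

  sumList-upTo-shift : (f : ℕ → ℝ) → ∀ n →
                       sumList f (upTo (suc n)) ≡ f 0 + sumList (f ∘ suc) (upTo n)
  sumList-upTo-shift f n = cong (f 0 +_)
    (trans (cong (sumList f) (sym (map-upTo suc n))) (sumList-map f suc (upTo n)))

  -- A finite set of naturals lies in an initial segment. As `upTo n` stops at `n - 1`, the segment
  -- has length one more than the maximum.
  initialSums-bound : {f : ℕ → ℝ} {b : ℝ} → Nonneg f → (∀ n → sumList f (upTo n) ≤ b) →
                      ∀ {is} → Unique is → sumList f is ≤ b
  initialSums-bound nn bound {is} u = ≤-trans
    (sumList-⊆ nn u λ i∈is → ∈-upTo⁺ (s≤s (All.lookup (xs≤max 0 is) i∈is)))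
    (bound (suc (max 0 is)))

  -- Split `f` into its part at `⊤⁺` and its part on the naturals. The latter is a sum of point
  -- masses, which `Swap` moves from `ℕ` to `ℕ∞`.
  HasSum-ℕ∞ : {f : ℕ∞ → ℝ} {s : ℝ} → Nonneg f →
              HasSum (f ∘ [_]) s → HasSum f (f ⊤⁺ + s)
  HasSum-ℕ∞ {f} nn h = HasSum-cong split (HasSum-+
      (restrict-nonneg (⊤⁺ ≡_) (λ _ → nn ⊤⁺))
      (λ a → HasSum⇒0≤ (S.column a))
      (HasSum-singleton (⊤⁺ ≡_) (λ _ → f ⊤⁺) ⊤⁺ (nn ⊤⁺) refl id)
      S.swap)
    where
    module S = Swap {f = λ n → restrict ([ n ] ≡_) (λ _ → f [ n ])}
      (λ n → restrict-nonneg ([ n ] ≡_) (λ _ → nn [ n ]))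
      (λ n → HasSum-singleton ([ n ] ≡_) (λ _ → f [ n ]) [ n ] (nn [ n ]) refl id) h
    split : (λ a → restrict (⊤⁺ ≡_) (λ _ → f ⊤⁺) a
                 + ∑ (λ n → restrict ([ n ] ≡_) (λ _ → f [ n ]) a)) ≗ f
    split [ m ] = trans
      (cong₂ _+_ (restrict-no (⊤⁺ ≡_) (λ _ → f ⊤⁺) λ ())
        (HasSum⇒∑≡ (HasSum-singleton (λ n → [ n ] ≡ [ m ]) (f ∘ [_]) m (nn [ m ]) refl
          (sym ∘ []-injective))))
      (+-identityˡ _)
    split ⊤⁺ = trans
      (cong₂ _+_ (restrict-yes (⊤⁺ ≡_) (λ _ → f ⊤⁺) refl)
        (HasSum⇒∑≡ (HasSum-cong
          (λ n → sym (restrict-no (λ n → [ n ] ≡ ⊤⁺) (f ∘ [_]) λ ())) HasSum-0)))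
      (+-identityʳ _)

  -- Distributions on ℕ∞ as sequences of initial sums

  -- φ([0,n)), so that cdf φ a is definitionally val (below (suc a) φ).
  below : ℕ → 𝒟 ℕ∞ → 𝕀
  below n φ = mk𝕀 (sumList (λ i → prob φ [ i ]) (upTo n))
    (sumList-nonneg (λ i → prob-nonneg φ [ i ]) (upTo n))
    (q-wellDefined.bound φ (Uniqueₚ.upTo⁺ n))

  below-mono : ∀ {φ ψ} → φ ⊑ ψ → ∀ n → below n φ ≤𝕀 below n ψ
  below-mono φ⊑ψ zero    = ≤-refl
  below-mono φ⊑ψ (suc a) = φ⊑ψ a

  below≤q : ∀ n φ → below n φ ≤𝕀 qₚ φ
  below≤q n φ = sumList≤ (q-wellDefined.sums φ) (Uniqueₚ.upTo⁺ n)

  -- With `below≤q`, this makes `qₚ φ` the supremum of the initial sums.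
  q≤ : ∀ φ {b} → (∀ n → val (below n φ) ≤ b) → val (qₚ φ) ≤ b
  q≤ φ bound = proj₂ (q-wellDefined.sums φ) λ { (_ , u , refl) →
    initialSums-bound (λ i → prob-nonneg φ [ i ]) bound u }

  -- Differences of consecutive initial sums recover the finite masses; total mass 1 then fixes the
  -- mass at `⊤⁺`.
  below-injective : ∀ {φ ψ} → (∀ n → below n φ ≡ below n ψ) → φ ≡ ψ
  below-injective {φ} {ψ} e = 𝒟-≡ same
    where
    finite : ∀ i → prob φ [ i ] ≡ prob ψ [ i ]
    finite i = +-cancelʳ (val (below i φ))
      (trans (sym (sumList-upTo-suc _ i))
        (trans (cong val (e (suc i)))
          (trans (sumList-upTo-suc _ i) (cong (prob ψ [ i ] +_) (cong val (sym (e i)))))))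
    total : ∀ χ → prob χ ⊤⁺ + q-value χ ≡ 1#
    total χ = HasSum-unique (HasSum-ℕ∞ (prob-nonneg χ) (q-wellDefined.sums χ)) (prob-sum χ)
    same : prob φ ≗ prob ψ
    same [ i ] = finite i
    same ⊤⁺ = +-cancelʳ (q-value φ) (trans (total φ)
      (trans (sym (total ψ)) (cong (prob ψ ⊤⁺ +_) (cong ∑ (sym (fe finite))))))

  -- The inverse construction. The increments of `G` serve as finite masses and telescope because
  -- `G 0` is 0; the bound 1 on `G` leaves a nonnegative remainder for `⊤⁺`.
  module FromInitialSums
    (G : ℕ → 𝕀) (G0≡0 : G 0 ≡ 0𝕀) (G-step : ∀ n → G n ≤𝕀 G (suc n)) where

    increment : ℕ → ℝ
    increment n = val (G (suc n)) + - val (G n)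

    increment-nonneg : Nonneg increment
    increment-nonneg n = ≤-minus (subst (_≤ _) (sym (+-identityˡ _)) (G-step n))

    telescope : ∀ n → sumList increment (upTo n) ≡ val (G n)
    telescope zero    = cong val (sym G0≡0)
    telescope (suc n) = trans (sumList-upTo-suc increment n)
      (trans (cong (increment n +_) (telescope n)) (neg-cancel _ _))

    initial≤1 : ∀ n → sumList increment (upTo n) ≤ 1#
    initial≤1 n = subst (_≤ 1#) (sym (telescope n)) (val≤1 (G n))

    increments : HasSum increment (∑ increment)
    increments = bounded⇒HasSum increment 1# (initialSums-bound increment-nonneg initial≤1)

    density : ℕ∞ → ℝ
    density [ n ] = increment n
    density ⊤⁺    = 1# + - ∑ increment

    density-nonneg : Nonneg density
    density-nonneg [ n ] = increment-nonneg n
    density-nonneg ⊤⁺    = ≤-minus (subst (_≤ 1#) (sym (+-identityˡ _))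
      (proj₂ increments λ { (_ , u , refl) →
        initialSums-bound increment-nonneg initial≤1 u }))

    dist : 𝒟 ℕ∞
    dist = mkDist density density-nonneg
      (subst (HasSum density) (neg-cancel 1# (∑ increment))
        (HasSum-ℕ∞ density-nonneg increments))

    below-dist : ∀ n → below n dist ≡ G n
    below-dist n = 𝕀-≡ (telescope n)

  -- The complete lattice of distributions and the continuity of `qₚ`

  ⊑-isPartialOrder : IsPartialOrder _≡_ _⊑_
  ⊑-isPartialOrder = record
    { isPreorder = record
      { isEquivalence = isEquivalence
      ; reflexive     = λ { refl _ → ≤-refl }
      ; trans         = λ p q a → ≤-trans (p a) (q a)
      }
    ; antisym = λ {φ} {ψ} p q → below-injective λ n →
        𝕀-≡ (≤-antisym (below-mono {φ} {ψ} p n) (below-mono {ψ} {φ} q n))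
    }

  below-step : ∀ n φ → below n φ ≤𝕀 below (suc n) φ
  below-step n φ = subst (val (below n φ) ≤_) (sym (sumList-upTo-suc _ n))
    (subst (_≤ prob φ [ n ] + val (below n φ)) (+-identityˡ _)
      (+-monoˡ-≤ (val (below n φ)) (prob-nonneg φ [ n ])))

  module Supremum (K : Pred (𝒟 ℕ∞) 0ℓ) where

    G : ℕ → 𝕀
    G n = ⨆𝕀 (Image (below n) K)

    G-upper : ∀ n {φ} → K φ → below n φ ≤𝕀 G n
    G-upper n {φ} Kφ = proj₁ (⨆𝕀-isLub (Image (below n) K)) (φ , Kφ , refl)

    G-least : ∀ n b → (∀ {φ} → K φ → below n φ ≤𝕀 b) → G n ≤𝕀 b
    G-least n b upper =
      proj₂ (⨆𝕀-isLub (Image (below n) K)) {b} λ { (φ , Kφ , refl) → upper Kφ }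

    open FromInitialSums G
      -- Every initial sum of length 0 is empty, so 0 is an upper bound, even when `K` is empty.
      (𝕀-≡ (≤-antisym (G-least 0 0𝕀 λ _ → ≤-refl) (0≤val (G 0))))
      (λ n → G-least n (G (suc n)) λ {φ} Kφ →
        ≤-trans (below-step n φ) (G-upper (suc n) Kφ))
      public

    isLub : IsLub _⊑_ K dist
    isLub = (λ {φ} Kφ a → subst (below (suc a) φ ≤𝕀_) (sym (below-dist (suc a))) (G-upper (suc a) Kφ))
          , (λ {b} upper a → subst (_≤𝕀 below (suc a) b) (sym (below-dist (suc a)))
              (G-least (suc a) (below (suc a) b) λ Kφ → upper Kφ a))

    -- Two suprema commute: the one over `n` that defines `qₚ` and the one over `K` that defines
    -- each `G n`.
    q-isLub : IsLub _≤𝕀_ (Image qₚ K) (qₚ dist)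
    q-isLub =
        (λ { (φ , Kφ , refl) → q≤ φ λ n → ≤-trans
             (below-mono {φ} {dist} (proj₁ isLub Kφ) n) (below≤q n dist) })
      , (λ {b} upper → q≤ dist λ n → subst (_≤𝕀 b) (sym (below-dist n))
          (G-least n b λ {φ} Kφ → ≤-trans (below≤q n φ) (upper (φ , Kφ , refl))))

  𝒟ℕ∞-complete : IsCompleteLattice _⊑_
  𝒟ℕ∞-complete = completeLattice ⊑-isPartialOrder Supremum.dist Supremum.isLub

  q-monotone : Monotone _⊑_ _≤𝕀_ qₚ
  q-monotone {φ} {ψ} φ⊑ψ = q≤ φ λ n → ≤-trans (below-mono {φ} {ψ} φ⊑ψ n) (below≤q n ψ)

  q-continuous : ∀ K → qₚ (Supremum.dist K) ≡ ⨆𝕀 (Image qₚ K)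
  q-continuous K = 𝕀-lub-unique (Supremum.q-isLub K) (⨆𝕀-isLub (Image qₚ K))

  q-strict : qₚ (Supremum.dist ∅) ≡ ⨆𝕀 ∅
  q-strict = 𝕀-≡ (≤-antisym
    (proj₂ (Supremum.q-isLub ∅) {⨆𝕀 ∅} λ { (_ , () , _) })
    (proj₂ (⨆𝕀-isLub ∅) {qₚ (Supremum.dist ∅)} λ ()))

  -- The algebra rₚ

  average-expectation : ∀ Γ b → ∑ (λ γ → prob Γ γ * prob γ b) ≡ average Γ b
  average-expectation Γ b = cong ∑ (fe (restrict-supp Γ (λ γ → prob γ b)))

  module _ (Γ : 𝒟 (𝒟 ℕ∞)) where

    -- Row `γ` sums to `prob Γ γ * q-value γ`, hence the whole matrix to the expectation of `qₚ`;
    -- its columns sum to the averages.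
    module Rows = Swap {f = λ γ i → prob Γ γ * prob γ [ i ]}
      (λ γ i → *-nonneg (prob-nonneg Γ γ) (prob-nonneg γ [ i ]))
      (λ γ → HasSum-* (prob-nonneg Γ γ) (q-wellDefined.sums γ))
      (σ-expectation Γ qₚ)

    averages-sum : HasSum (λ i → average Γ [ i ]) (val (σₚ (F₁ qₚ (Γ , 0F))))
    averages-sum = HasSum-cong (λ i → average-expectation Γ [ i ]) Rows.swap

    -- Only finitely many columns are added here, so summing over `γ` commutes with it and
    -- `prob Γ γ` factors out.
    averages-initial : ∀ n → sumList (λ i → average Γ [ i ]) (upTo n)
                           ≡ val (σₚ (F₁ (below n) (Γ , 0F)))
    averages-initial n = trans
      (sumList-cong (λ i → sym (average-expectation Γ [ i ])) (upTo n))
      (HasSum-unique (Rows.columns (upTo n))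
        (HasSum-cong (λ γ → sym (sumList-* (prob Γ γ) (λ i → prob γ [ i ]) (upTo n)))
          (σ-expectation Γ (below n))))

  -- The index drops by one because `rₚ` shifts masses up by one. Position 0 receives mass 1 if `t`
  -- is 1, and 0 otherwise.
  below-r : ∀ n u → below (suc n) (rₚ u) ≡ σₚ (F₁ (below n) u)
  below-r n (Γ , 1F) = 𝕀-≡ (trans (sumList-upTo-shift _ n)
    (trans (cong (1# +_) (sumList-0 (upTo n))) (+-identityʳ 1#)))
  below-r n (Γ , 0F) = 𝕀-≡ (trans (sumList-upTo-shift _ n)
    (trans (+-identityˡ _) (averages-initial Γ n)))

  below-Φr : {X : Set} (f : X → 𝒟 ℕ∞) → ∀ n u →
             below (suc n) (rₚ (F₁ f u)) ≡ σₚ (F₁ (below n ∘ f) u)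
  below-Φr f n u = trans (below-r n (F₁ f u)) (cong σₚ (sym (homomorphism f (below n) u)))

  q-r : ∀ u → qₚ (rₚ u) ≡ σₚ (F₁ qₚ u)
  q-r u = 𝕀-≡ (≤-antisym (q≤ (rₚ u) upper) (lower u))
    where
    upper : ∀ n → below n (rₚ u) ≤𝕀 σₚ (F₁ qₚ u)
    upper n = ≤-trans (below-step n (rₚ u))
      (subst (_≤𝕀 σₚ (F₁ qₚ u)) (sym (below-r n u)) (σF-mono (below≤q n) u))
    lower : ∀ u → σₚ (F₁ qₚ u) ≤𝕀 qₚ (rₚ u)
    -- The mass at 0 is already 1.
    lower (Γ , 1F) = term≤ (q-wellDefined.sums (rₚ (Γ , 1F))) 0
    lower (Γ , 0F) = proj₂ (averages-sum Γ) λ { (is , u , refl) →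
      -- A finite sum of averages over `is` is a sum of masses of `rₚ (Γ , 0F)` over the successors
      -- of `is`.
      subst (_≤ _) (sumList-map _ suc is)
        (sumList≤ (q-wellDefined.sums (rₚ (Γ , 0F))) (Uniqueₚ.map⁺ suc-injective u)) }

  -- The order compares initial sums of length `suc a`, and `below-Φr` expresses these through the
  -- monotone `σₚ`.
  Φr-monotone : Φ-Monotone Fₚ _⊑_ rₚ
  Φr-monotone c {f} {g} f⊑g x a =
    subst (_≤𝕀 below (suc a) (rₚ (F₁ g (c x)))) (sym (below-Φr f a (c x)))
      (subst (σₚ (F₁ (below a ∘ f) (c x)) ≤𝕀_) (sym (below-Φr g a (c x)))
        (σF-mono (λ y → below-mono {f y} {g y} (f⊑g y) a) (c x)))

  -- Corecursiveness of `rₚ`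

  module Corecursion {X : Set} (c : X → Functor.F₀ Fₚ X) where

    iterate : ℕ → X → 𝕀
    iterate zero    x = 0𝕀
    iterate (suc n) x = Φ Fₚ c σₚ (iterate n) x

    -- The iteration starts at the least element, and monotonicity of `σₚ` propagates the first
    -- inequality.
    iterate-step : ∀ n x → iterate n x ≤𝕀 iterate (suc n) x
    iterate-step zero    x = 0≤val (iterate 1 x)
    iterate-step (suc n) x = σF-mono (iterate-step n) (c x)

    module Solution (x : X) =
      FromInitialSums (λ n → iterate n x) refl (λ n → iterate-step n x)

    solution : X → 𝒟 ℕ∞
    solution = Solution.dist

    -- Each unfolding of the equation determines one more initial sum, so no limit argument is
    -- involved.
    fixpoint⇒iterate : ∀ {f} → f ≡ Φ Fₚ c rₚ f → ∀ n → below n ∘ f ≡ iterate n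
    fixpoint⇒iterate e zero    = refl
    fixpoint⇒iterate {f} e (suc n) = fe λ x → trans
      (cong (λ h → below (suc n) (h x)) e)
      (trans (below-Φr f n (c x)) (cong (λ h → σₚ (F₁ h (c x))) (fixpoint⇒iterate e n)))

    solution-fixpoint : solution ≡ Φ Fₚ c rₚ solution
    solution-fixpoint = fe λ x → below-injective (same x)
      where
      same : ∀ x n → below n (solution x) ≡ below n (Φ Fₚ c rₚ solution x)
      -- `below-r` says nothing about length 0, but there both sums are empty.
      same x zero    = refl
      same x (suc n) = trans (Solution.below-dist x (suc n))
        (sym (trans (below-Φr solution n (c x))
          (cong (λ h → σₚ (F₁ h (c x))) (fe λ y → Solution.below-dist y n))))

    solution-unique : ∀ {f} → f ≡ Φ Fₚ c rₚ f → solution ≡ f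
    solution-unique e = fe λ x → below-injective λ n →
      trans (Solution.below-dist x n) (cong (λ h → h x) (sym (fixpoint⇒iterate e n)))

  isRankingDomain : IsRankingDomain Fₚ _≤𝕀_ 𝕀-complete σₚ Φσ-monotone rₚ qₚ _⊑_
  isRankingDomain = record
    { q∘r⊑σ∘Fq     = λ u → ≤-reflexive (cong val (q-r u))
    ; R-complete   = 𝒟ℕ∞-complete
    ; Φr-monotone  = λ c {f} {g} → Φr-monotone c {f} {g}
    ; q-monotone   = λ {φ} {ψ} → q-monotone {φ} {ψ}
    ; q-strict     = q-strict
    ; q-continuous = q-continuous
    ; corecursive  = λ c → let open Corecursion c in
                       solution , solution-fixpoint , solution-unique
    }

mainTheorem2 : (em : ExcludedMiddle 0ℓ) (fe : Extensionality 0ℓ 0ℓ) (𝐑 : CompleteOrderedField) →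
    let open Probabilistic em fe 𝐑 in
    Σ[ 𝕀-complete ∈ IsCompleteLattice _≤𝕀_ ]
    Σ[ Φσ-monotone ∈ Φ-Monotone Fₚ _≤𝕀_ σₚ ]
    (IsRankingDomain Fₚ _≤𝕀_ 𝕀-complete σₚ Φσ-monotone rₚ qₚ _⊑_
    × (qₚ ∘ rₚ ≡ σₚ ∘ Functor.F₁ Fₚ qₚ))
mainTheorem2 em fe 𝐑 = 𝕀-complete , Φσ-monotone , isRankingDomain , fe q-r
  where open RankingDomain em fe 𝐑
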